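{- Let $d\ge1$ and $n>2d$ be integers and let $\Delta$ be a traceable pure $d$-dimensional simplicial complex on $n$ vertices. Suppose that every labeling that makes $\Delta$ weakly-traceable also makes $\Delta$ traceable. Let $\sigma_1,\dots,\sigma_s$ be the $(d-1)$-faces of $\Delta$, ordered so that $d_1\le d_2\le\dots\le d_s$, where $d_i$ is the number of $d$-faces of $\Delta$ containing $\sigma_i$. If for every integer $k$ with $d\le k<\frac n2$ one has $d_{k-d+1}>k$, then $\Delta$ is weakly-Hamiltonian.
   Context: A labeling of a simplicial complex with $n$ vertices is a bijection of its vertex set with $\{1,\dots,n\}$. Given a labeling, for $i\in\{1,\dots,n\}$ let $H_i$ be the $(d+1)$-element set $\{i,i+1,\dots,i+d\}$, where labels are read modulo $n$ (so $n+1$ means $1$, etc.). A labeling makes $\Delta$ traceable if $H_1,\dots,H_{n-d}$ are all faces of $\Delta$; $\Delta$ is traceable if some labeling makes it traceable. A labeling makes $\Delta$ weakly-traceable if there are indices $1\le i_1<\dots<i_k\le n-d$ such that $H_{i_1},\dots,H_{i_k}$ are faces of $\Delta$, together they cover all vertices, and $H_{i_j}\cap H_{i_{j+1}}\ne\emptyset$ for each $j\in\{1,\dots,k-1\}$. $\Delta$ is weakly-Hamiltonian if it has a labeling for which there are indices $1\le i_1<\dots<i_k\le n$ such that $H_{i_1},\dots,H_{i_k}$ are faces of $\Delta$, together they cover all vertices, $H_{i_j}\cap H_{i_{j+1}}\neq\emptyset$ for each $j\in\{1,\dots,k-1\}$, and $H_{i_k}\cap H_{i_1}\ne\emptyset$.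 -}

module Defs where

open import Data.Nat using (ℕ; zero; suc; _+_; _∸_; _≤_; _<_)
import Data.Nat.Properties as ℕ
open import Data.Nat.DivMod using (_mod_)
open import Data.Fin as Fin using (Fin; toℕ; fromℕ; inject₁)
open import Data.Fin.Properties using (nonZeroIndex)
open import Data.Fin.Permutation using (Permutation′; _⟨$⟩ˡ_)
open import Data.Fin.Subset using (Subset; inside; outside; ⊥; ⁅_⁆; _∈_; _⊆_; _∩_; ⋃; ∣_∣; Nonempty)
open import Data.Fin.Subset.Properties using (_⊆?_)
open import Data.List using (List; [_]; _++_; map; filter; length; upTo)
open import Data.Vec using ([]; _∷_)
open import Data.Product using (Σ-syntax; ∃-syntax; _×_)
open import Function.Definitions using (Injective)
open import Relation.Nullary.Decidable using (_×-dec_)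
open import Relation.Unary using (Decidable)
open import Relation.Binary.PropositionalEquality using (_≡_)

-- The vertex set is Fin n, and every element of it is a vertex.  Being a face
-- is decidable, as it is for any explicitly given finite complex.
record SimplicialComplex (n : ℕ) : Set₁ where
  field
    Face          : Subset n → Set
    face?         : Decidable Face
    empty-face    : Face ⊥
    vertex-face   : ∀ v → Face ⁅ v ⁆
    down-closed   : ∀ {p q} → p ⊆ q → Face q → Face p

allSubsets : ∀ n → List (Subset n)
allSubsets zero    = [ [] ]
allSubsets (suc n) = map (outside ∷_) (allSubsets n) ++ map (inside ∷_) (allSubsets n)

-- π ⟨$⟩ʳ v is the label of v and π ⟨$⟩ˡ l is the vertex labeled l.
-- Labels run over 0, …, n-1 instead of 1, …, n.
Labeling : ℕ → Set
Labeling = Permutation′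

-- The set of vertices labeled i, i+1, …, i+d modulo n; with labels starting
-- at 0, this is the set usually written H_{i+1}.
H : ∀ {n} → ℕ → Labeling n → Fin n → Subset n
H {n} d π i = ⋃ (map (λ j → ⁅ π ⟨$⟩ˡ label j ⁆) (upTo (suc d)))
  where
  label : ℕ → Fin n
  label j = _mod_ (toℕ i + j) n {{nonZeroIndex i}}

module _ {n : ℕ} (Δ : SimplicialComplex n) where
  open SimplicialComplex Δ

  IsFacet : Subset n → Set
  IsFacet F = Face F × (∀ G → Face G → F ⊆ G → F ≡ G)

  -- Δ has a face, so it has a facet, and this condition forces dim Δ = d.
  PureOfDim : ℕ → Set
  PureOfDim d = ∀ F → IsFacet F → ∣ F ∣ ≡ suc d

  FaceOfDim : ℕ → Subset n → Set
  FaceOfDim k F = Face F × ∣ F ∣ ≡ suc k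

  faceOfDim? : ∀ k → Decidable (FaceOfDim k)
  faceOfDim? k F = face? F ×-dec (∣ F ∣ ℕ.≟ suc k)

  -- The number of d-faces containing σ.
  degree : ℕ → Subset n → ℕ
  degree d σ = length (filter (λ τ → faceOfDim? d τ ×-dec (σ ⊆? τ)) (allSubsets n))

  -- Meant for d ≥ 1 only, because of d ∸ 1.
  record DegreeOrderedRidges (d s : ℕ) (σ : Fin s → Subset n) : Set where
    field
      faces     : ∀ j → FaceOfDim (d ∸ 1) (σ j)
      distinct  : Injective _≡_ _≡_ σ
      complete  : ∀ F → FaceOfDim (d ∸ 1) F → ∃[ j ] σ j ≡ F
      monotone  : ∀ j l → j Fin.≤ l → degree d (σ j) ≤ degree d (σ l)

  -- As labels start at 0, the indices 1, …, n-d are the i with i + d < n.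
  MakesTraceable : ℕ → Labeling n → Set
  MakesTraceable d π = ∀ i → toℕ i + d < n → Face (H d π i)

  Traceable : ℕ → Set
  Traceable d = ∃[ π ] MakesTraceable d π

  -- The indices i_1 < … < i_k, where k = suc m: k = 0 is excluded by the
  -- covering condition as soon as there is a vertex.
  record WeakChain (d : ℕ) (π : Labeling n) (m : ℕ) (i : Fin (suc m) → Fin n) : Set where
    field
      increasing : ∀ j l → j Fin.< l → i j Fin.< i l
      faces      : ∀ j → Face (H d π (i j))
      covering   : ∀ v → ∃[ j ] v ∈ H d π (i j)
      meeting    : ∀ (j : Fin m) → Nonempty (H d π (i (inject₁ j)) ∩ H d π (i (Fin.suc j)))

  MakesWeaklyTraceable : ℕ → Labeling n → Set
  MakesWeaklyTraceable d π =
    Σ[ m ∈ ℕ ] Σ[ i ∈ (Fin (suc m) → Fin n) ]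
      WeakChain d π m i × (∀ j → toℕ (i j) + d < n)

  WeaklyHamiltonian : ℕ → Set
  WeaklyHamiltonian d =
    Σ[ π ∈ Labeling n ] Σ[ m ∈ ℕ ] Σ[ i ∈ (Fin (suc m) → Fin n) ]
      WeakChain d π m i × Nonempty (H d π (i (fromℕ m)) ∩ H d π (i Fin.zero))

{-# OPTIONS --safe #-}

-- This is Pósa's rotation argument.  Put N = n - d and list the vertices by their positions
-- 0, …, n-1.  Let a and b be the degrees of the ridges on the first and on the last d positions.
-- If position q extends the last ridge to a face and position q+1 extends the first one, then
-- reversing the positions q+1, …, n-1 gives a weakly-Hamiltonian cycle.  If no such crossing
-- exists, then a + b < n, so after possibly reversing the labeling 2a < n.  For every position
-- p < N that extends the first ridge, reversing 0, …, p-1 gives a weakly-traceable, hence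
-- traceable, labeling with the same last ridge, whose first ridge is the window ending at p-1.
-- If none of these windows has degree above a, there are too many ridges of degree at most a;
-- otherwise a + b increases, which can happen only finitely often.
module Submission where

open import Defs
open import Data.Nat using (ℕ; zero; suc; _+_; _*_; _∸_; _≤_; _<_; z≤n; s≤s; z<s; s≤s⁻¹; NonZero)
open import Data.Nat.Properties
open import Data.Nat.DivMod using (_mod_; m%n<n; m<n⇒m%n≡m; [m+n]%n≡m%n)
open import Data.Fin as Fin using (Fin; toℕ; fromℕ; fromℕ<; inject₁)
open import Data.Fin.Properties using (toℕ<n; toℕ-fromℕ<; toℕ-injective; toℕ-inject₁; fromℕ<-toℕ; fromℕ<-cong; fromℕ<-injective)
open import Data.Fin.Permutation using (permutation; _∘ₚ_; _⟨$⟩ˡ_; _⟨$⟩ʳ_; inverseˡ; inverseʳ)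
open import Data.Fin.Subset using (Subset; inside; outside; ⁅_⁆; _∈_; _∉_; _⊆_; _∪_; ⋃; ∣_∣)
open import Data.Fin.Subset.Properties using (drop-∷-⊆; drop-there; ∪-identityˡ; ∪-identityʳ; ∉⊥; ∣⊥∣≡0; x∈⁅x⁆; x∈⁅y⁆⇒x≡y; x∈p∪q⁻; p⊆p∪q; q⊆p∪q; x∈p∩q⁺; p⊆q⇒∣p∣≤∣q∣; _∈?_)
open import Data.Vec using ([]; _∷_; here; there)
import Data.Vec.Properties as Vec
open import Data.List using (List; []; _∷_; _++_; map; filter; length; upTo; downFrom)
open import Data.List.Properties using (length-++; length-upTo; length-downFrom)
import Data.List.Membership.Propositional as List
open import Data.List.Membership.Propositional.Properties using (∈-∃++; ∈-++⁻; ∈-++⁺ˡ; ∈-++⁺ʳ; ∈-map⁻; ∈-upTo⁺; ∈-upTo⁻; ∈-downFrom⁺; ∈-downFrom⁻; ∈-filter⁺; ∈-filter⁻)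
open import Data.List.Relation.Unary.Any using (here; there)
import Data.List.Relation.Unary.All as All
open import Data.List.Relation.Unary.All using ([]; _∷_)
open import Data.List.Relation.Unary.AllPairs using (AllPairs; []; _∷_)
import Data.List.Relation.Unary.AllPairs.Properties as AllPairs
open import Data.List.Relation.Unary.Unique.Propositional using (Unique)
import Data.List.Relation.Unary.Unique.Propositional.Properties as Unique
open import Data.Product using (∃-syntax; _×_; _,_; proj₁; proj₂)
open import Data.Sum using (_⊎_; inj₁; inj₂; [_,_]′)
open import Function using (_∘_; case_of_; id)
open import Relation.Nullary using (¬_; Dec; yes; no; contradiction; ¬?)
open import Relation.Nullary.Decidable using (_×-dec_)
open import Relation.Unary using (Decidable)
open import Relation.Binary.PropositionalEquality

-- Counting along injective relations and on initial segments of the naturals.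

module _ {A B : Set} (R : A → B → Set) (R-injective : ∀ {x x′ y} → R x y → R x′ y → x ≡ x′) where

  -- The partner of the head is deleted from `ys`; by `R-injective` no later entry has the same
  -- partner, so the rest still matches into what remains.
  pigeonhole-≤ : ∀ {xs} → Unique xs → (ys : List B) →
                 (∀ {x} → x List.∈ xs → ∃[ y ] y List.∈ ys × R x y) → length xs ≤ length ys
  pigeonhole-≤ []           ys f = z≤n
  pigeonhole-≤ {x ∷ xs} (x≢ ∷ xs!) ys f with f (here refl)
  ... | y , y∈ys , Rxy with ∈-∃++ y∈ys
  ... | as , bs , refl = begin
    suc (length xs)          ≤⟨ s≤s (pigeonhole-≤ xs! (as ++ bs) g) ⟩
    suc (length (as ++ bs))  ≡⟨ cong suc (length-++ as) ⟩
    suc (length as + length bs) ≡⟨ +-suc (length as) (length bs) ⟨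
    length as + suc (length bs) ≡⟨ length-++ as ⟨
    length (as ++ y ∷ bs)    ∎
    where
    open ≤-Reasoning
    g : ∀ {x′} → x′ List.∈ xs → ∃[ y′ ] y′ List.∈ (as ++ bs) × R x′ y′
    g x′∈xs with f (there x′∈xs)
    ... | y′ , y′∈ys , Rx′y′ with ∈-++⁻ as y′∈ys
    ... | inj₁ y′∈as         = y′ , ∈-++⁺ˡ y′∈as , Rx′y′
    ... | inj₂ (there y′∈bs) = y′ , ∈-++⁺ʳ as y′∈bs , Rx′y′
    ... | inj₂ (here refl)   = contradiction (R-injective Rxy Rx′y′) (All.lookup x≢ x′∈xs)

-- `downFrom (suc m)` has `m` at its head, so an induction on the bound tests one new number at a
-- time.
count : {P : ℕ → Set} → Decidable P → ℕ → ℕ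
count P? m = length (filter P? (downFrom m))

module _ {P : ℕ → Set} (P? : Decidable P) where

  count-suc-≤ : ∀ m → count P? (suc m) ≤ suc (count P? m)
  count-suc-≤ m with P? m
  ... | yes _ = ≤-refl
  ... | no  _ = n≤1+n _

  count-reject : ∀ {m} → ¬ P m → count P? (suc m) ≡ count P? m
  count-reject {m} ¬p with P? m
  ... | yes p = contradiction p ¬p
  ... | no  _ = refl

  count-+-≤ : ∀ m k → count P? (m + k) ≤ count P? m + k
  count-+-≤ m zero    = ≤-reflexive (trans (cong (count P?) (+-identityʳ m)) (sym (+-identityʳ _)))
  count-+-≤ m (suc k) = begin
    count P? (m + suc k)   ≡⟨ cong (count P?) (+-suc m k) ⟩
    count P? (suc (m + k)) ≤⟨ count-suc-≤ (m + k) ⟩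
    suc (count P? (m + k)) ≤⟨ s≤s (count-+-≤ m k) ⟩
    suc (count P? m + k)   ≡⟨ +-suc _ k ⟨
    count P? m + suc k     ∎
    where open ≤-Reasoning

  -- Shifting the elements of `P` down by one loses nothing, as 0 is not among them, and the shifted
  -- set is disjoint from `Q` within 0, ..., m-1.
  count-shifted : {Q : ℕ → Set} (Q? : Decidable Q) → ¬ P 0 → ∀ m →
                  (∀ {x} → x < m → P (suc x) → ¬ Q x) → count P? (suc m) + count Q? m ≤ m
  count-shifted Q? ¬P0 zero    _   = ≤-reflexive (trans (+-identityʳ _) (count-reject ¬P0))
  count-shifted Q? ¬P0 (suc m) dis with ih ← count-shifted Q? ¬P0 m (λ x<m → dis (m≤n⇒m≤1+n x<m))
    | P? (suc m) | Q? m
  ... | yes p | yes q = contradiction q (dis ≤-refl p)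
  ... | yes p | no  _ = s≤s ih
  ... | no  _ | yes q = ≤-trans (≤-reflexive (+-suc _ _)) (s≤s ih)
  ... | no  _ | no  _ = m≤n⇒m≤1+n ih

-- Finite subsets and their cardinalities.

allSubsets-unique : ∀ n → Unique (allSubsets n)
allSubsets-unique zero    = [] ∷ []
allSubsets-unique (suc n) = Unique.++⁺ (Unique.map⁺ Vec.∷-injectiveʳ u) (Unique.map⁺ Vec.∷-injectiveʳ u)
  λ (v∈out , v∈in) → case (∈-map⁻ _ v∈out , ∈-map⁻ _ v∈in) of λ where
    ((_ , _ , refl) , (_ , _ , ()))
  where u = allSubsets-unique n

∣⁅x⁆∪p∣≡1+∣p∣ : ∀ {n} {p : Subset n} {x} → x ∉ p → ∣ ⁅ x ⁆ ∪ p ∣ ≡ suc ∣ p ∣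
∣⁅x⁆∪p∣≡1+∣p∣ {p = inside  ∷ p} {Fin.zero}  x∉p = contradiction here x∉p
∣⁅x⁆∪p∣≡1+∣p∣ {p = outside ∷ p} {Fin.zero}  x∉p = cong suc (cong ∣_∣ (∪-identityˡ p))
∣⁅x⁆∪p∣≡1+∣p∣ {p = inside  ∷ p} {Fin.suc x} x∉p = cong suc (∣⁅x⁆∪p∣≡1+∣p∣ (x∉p ∘ there))
∣⁅x⁆∪p∣≡1+∣p∣ {p = outside ∷ p} {Fin.suc x} x∉p = ∣⁅x⁆∪p∣≡1+∣p∣ (x∉p ∘ there)

p⊆q∧∣p∣≡∣q∣⇒p≡q : ∀ {n} {p q : Subset n} → p ⊆ q → ∣ p ∣ ≡ ∣ q ∣ → p ≡ q
p⊆q∧∣p∣≡∣q∣⇒p≡q {p = []}          {[]}          _   _  = refl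
p⊆q∧∣p∣≡∣q∣⇒p≡q {p = inside  ∷ p} {inside  ∷ q} p⊆q eq = cong (inside ∷_) (p⊆q∧∣p∣≡∣q∣⇒p≡q (drop-∷-⊆ p⊆q) (suc-injective eq))
p⊆q∧∣p∣≡∣q∣⇒p≡q {p = inside  ∷ p} {outside ∷ q} p⊆q eq = case p⊆q here of λ ()
p⊆q∧∣p∣≡∣q∣⇒p≡q {p = outside ∷ p} {inside  ∷ q} p⊆q eq =
  contradiction (p⊆q⇒∣p∣≤∣q∣ (drop-∷-⊆ p⊆q)) (<⇒≱ (≤-reflexive (sym eq)))
p⊆q∧∣p∣≡∣q∣⇒p≡q {p = outside ∷ p} {outside ∷ q} p⊆q eq = cong (outside ∷_) (p⊆q∧∣p∣≡∣q∣⇒p≡q (drop-∷-⊆ p⊆q) eq)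

p⊆q∧∣q∣≡1+∣p∣⇒q≡p∪⁅x⁆ : ∀ {n} {p q : Subset n} → p ⊆ q → ∣ q ∣ ≡ suc ∣ p ∣ → ∃[ x ] x ∉ p × q ≡ p ∪ ⁅ x ⁆
p⊆q∧∣q∣≡1+∣p∣⇒q≡p∪⁅x⁆ {p = []}          {[]}          _   ()
p⊆q∧∣q∣≡1+∣p∣⇒q≡p∪⁅x⁆ {p = inside  ∷ p} {outside ∷ q} p⊆q _ = case p⊆q here of λ ()
p⊆q∧∣q∣≡1+∣p∣⇒q≡p∪⁅x⁆ {p = outside ∷ p} {inside  ∷ q} p⊆q eq =
  Fin.zero , (λ ()) , cong (inside ∷_) (trans (sym (p⊆q∧∣p∣≡∣q∣⇒p≡q (drop-∷-⊆ p⊆q) (sym (suc-injective eq)))) (sym (∪-identityʳ p)))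
p⊆q∧∣q∣≡1+∣p∣⇒q≡p∪⁅x⁆ {p = inside  ∷ p} {inside  ∷ q} p⊆q eq
  with x , x∉p , refl ← p⊆q∧∣q∣≡1+∣p∣⇒q≡p∪⁅x⁆ (drop-∷-⊆ p⊆q) (suc-injective eq) = Fin.suc x , x∉p ∘ drop-there , refl
p⊆q∧∣q∣≡1+∣p∣⇒q≡p∪⁅x⁆ {p = outside ∷ p} {outside ∷ q} p⊆q eq
  with x , x∉p , refl ← p⊆q∧∣q∣≡1+∣p∣⇒q≡p∪⁅x⁆ (drop-∷-⊆ p⊆q) eq = Fin.suc x , x∉p ∘ drop-there , refl

module _ {A : Set} {n : ℕ} (f : A → Fin n) where

  ∈-⋃⁅⁆⁺ : ∀ {xs x} → x List.∈ xs → f x ∈ ⋃ (map (λ y → ⁅ f y ⁆) xs)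
  ∈-⋃⁅⁆⁺ (here refl) = p⊆p∪q _ (x∈⁅x⁆ _)
  ∈-⋃⁅⁆⁺ (there x∈)  = q⊆p∪q _ _ (∈-⋃⁅⁆⁺ x∈)

  ∈-⋃⁅⁆⁻ : ∀ xs {v} → v ∈ ⋃ (map (λ y → ⁅ f y ⁆) xs) → ∃[ x ] x List.∈ xs × v ≡ f x
  ∈-⋃⁅⁆⁻ []       v∈ = contradiction v∈ ∉⊥
  ∈-⋃⁅⁆⁻ (x ∷ xs) v∈ with x∈p∪q⁻ ⁅ f x ⁆ _ v∈
  ... | inj₁ v∈fx = x , here refl , x∈⁅y⁆⇒x≡y _ v∈fx
  ... | inj₂ v∈xs with y , y∈xs , eq ← ∈-⋃⁅⁆⁻ xs v∈xs = y , there y∈xs , eq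

  ∣⋃⁅⁆∣ : ∀ {xs} → AllPairs (λ x y → f x ≢ f y) xs → ∣ ⋃ (map (λ y → ⁅ f y ⁆) xs) ∣ ≡ length xs
  ∣⋃⁅⁆∣ []         = ∣⊥∣≡0 n
  ∣⋃⁅⁆∣ {x ∷ xs} (x≢ ∷ xs!) = trans (∣⁅x⁆∪p∣≡1+∣p∣ fx∉) (cong suc (∣⋃⁅⁆∣ xs!))
    where
    fx∉ : f x ∉ ⋃ (map (λ y → ⁅ f y ⁆) xs)
    fx∉ fx∈ with y , y∈xs , eq ← ∈-⋃⁅⁆⁻ xs fx∈ = All.lookup x≢ y∈xs eq

-- Paths of window positions.

-- Nodes stand for the starting positions of windows of length d+1; a step of at most `d` makes
-- consecutive windows meet and leaves no gap between them. The inductive form makes concatenation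
-- easy.
data Path (P : ℕ → Set) (d : ℕ) : ℕ → ℕ → Set where
  stop : ∀ {x} → P x → Path P d x x
  step : ∀ {x y z} → P x → x < y → y ≤ x + d → Path P d y z → Path P d x z

module _ {P : ℕ → Set} {d : ℕ} where

  _⟨_,_⟩++_ : ∀ {x y y′ z} → Path P d x y → y < y′ → y′ ≤ y + d → Path P d y′ z → Path P d x z
  stop p        ⟨ a , b ⟩++ r = step p a b r
  step p u v q  ⟨ a , b ⟩++ r = step p u v (q ⟨ a , b ⟩++ r)

  run : 1 ≤ d → ∀ {x y} → x ≤ y → (∀ {z} → x ≤ z → z ≤ y → P z) → Path P d x y
  run 1≤d {x} {zero}  z≤n h = stop (h z≤n z≤n)
  run 1≤d {x} {suc y} x≤y h with x ≤? y
  ... | yes x≤y′ = run 1≤d x≤y′ (λ a b → h a (m≤n⇒m≤1+n b)) ⟨ ≤-refl , m<m+n y 1≤d ⟩++ stop (h x≤y ≤-refl)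
  ... | no  x≰y  with refl ← ≤-antisym x≤y (≰⇒> x≰y) = stop (h ≤-refl ≤-refl)

  len : ∀ {x y} → Path P d x y → ℕ
  len (stop _)       = 0
  len (step _ _ _ r) = suc (len r)

  node : ∀ {x y} (r : Path P d x y) → Fin (suc (len r)) → ℕ
  node {x} r              Fin.zero    = x
  node     (step _ _ _ r) (Fin.suc j) = node r j

  node-P : ∀ {x y} (r : Path P d x y) j → P (node r j)
  node-P (stop p)       Fin.zero    = p
  node-P (step p _ _ r) Fin.zero    = p
  node-P (step _ _ _ r) (Fin.suc j) = node-P r j

  node-last : ∀ {x y} (r : Path P d x y) → node r (fromℕ (len r)) ≡ y
  node-last (stop _)       = refl
  node-last (step _ _ _ r) = node-last r

  x≤node : ∀ {x y} (r : Path P d x y) j → x ≤ node r j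
  x≤node r                Fin.zero    = ≤-refl
  x≤node (step _ x<y _ r) (Fin.suc j) = ≤-trans (<⇒≤ x<y) (x≤node r j)

  node≤y : ∀ {x y} (r : Path P d x y) j → node r j ≤ y
  node≤y (stop _)         Fin.zero    = ≤-refl
  node≤y (step _ x<y _ r) Fin.zero    = ≤-trans (<⇒≤ x<y) (node≤y r Fin.zero)
  node≤y (step _ _ _ r)   (Fin.suc j) = node≤y r j

  node-increasing : ∀ {x y} (r : Path P d x y) j l → j Fin.< l → node r j < node r l
  node-increasing (step _ x<y _ r) Fin.zero    (Fin.suc l) _         = ≤-trans x<y (x≤node r l)
  node-increasing (step _ _ _ r)   (Fin.suc j) (Fin.suc l) (s≤s j<l) = node-increasing r j l j<l

  node-gap : ∀ {x y} (r : Path P d x y) (j : Fin (len r)) → node r (Fin.suc j) ≤ node r (inject₁ j) + d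
  node-gap (step _ _ y≤x+d r) Fin.zero    = y≤x+d
  node-gap (step _ _ _ r)     (Fin.suc j) = node-gap r j

  -- A number below the second node still lies in the first window, because the step to that node is
  -- at most `d`.
  node-cover : ∀ {x y} (r : Path P d x y) {q} → x ≤ q → q ≤ y + d → ∃[ j ] node r j ≤ q × q ≤ node r j + d
  node-cover (stop _) x≤q q≤ = Fin.zero , x≤q , q≤
  node-cover (step {y = y} _ _ y≤x+d r) {q} x≤q q≤ with y ≤? q
  ... | no  y≰q = Fin.zero , x≤q , ≤-trans (<⇒≤ (≰⇒> y≰q)) y≤x+d
  ... | yes y≤q with j , a , b ← node-cover r y≤q q≤ = Fin.suc j , a , b

-- Reversal of an interval of positions.

-- Reverses the half-open interval [a, c) and fixes the other numbers.
reverse : ℕ → ℕ → ℕ → ℕ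
reverse a c x with a ≤? x | x <? c
... | yes _ | yes _ = a + c ∸ suc x
... | _     | _     = x

module _ {a c : ℕ} where

  -- An equation between sums, so that later arguments cancel terms instead of handling truncated
  -- subtraction.
  reverse-inside : ∀ {x} → a ≤ x → x < c → reverse a c x + suc x ≡ a + c
  reverse-inside {x} a≤x x<c with a ≤? x | x <? c
  ... | yes _   | yes _   = m∸n+n≡m (≤-trans x<c (m≤n+m c a))
  ... | no  a≰x | _       = contradiction a≤x a≰x
  ... | yes _   | no x≮c  = contradiction x<c x≮c

  reverse-outside : ∀ {x} → x < a ⊎ c ≤ x → reverse a c x ≡ x
  reverse-outside {x} out with a ≤? x | x <? c
  ... | no _    | _       = refl
  ... | yes _   | no _    = refl
  ... | yes a≤x | yes x<c = case out of λ where
    (inj₁ x<a) → contradiction a≤x (<⇒≱ x<a)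
    (inj₂ c≤x) → contradiction x<c (≤⇒≯ c≤x)

  inside-or-outside : ∀ x → (a ≤ x × x < c) ⊎ (x < a ⊎ c ≤ x)
  inside-or-outside x with a ≤? x | x <? c
  ... | yes a≤x | yes x<c = inj₁ (a≤x , x<c)
  ... | no  a≰x | _       = inj₂ (inj₁ (≰⇒> a≰x))
  ... | yes _   | no x≮c  = inj₂ (inj₂ (≮⇒≥ x≮c))

  reverse-≥ : ∀ {x} → a ≤ x → x < c → a ≤ reverse a c x
  reverse-≥ {x} a≤x x<c = +-cancelʳ-≤ (suc x) a _
    (≤-trans (+-monoʳ-≤ a x<c) (≤-reflexive (sym (reverse-inside a≤x x<c))))

  reverse-< : ∀ {x} → a ≤ x → x < c → reverse a c x < c
  reverse-< {x} a≤x x<c = +-cancelʳ-≤ x _ c (begin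
    suc (reverse a c x) + x  ≡⟨ +-suc _ x ⟨
    reverse a c x + suc x    ≡⟨ reverse-inside a≤x x<c ⟩
    a + c                    ≤⟨ +-monoˡ-≤ c a≤x ⟩
    x + c                    ≡⟨ +-comm x c ⟩
    c + x                    ∎)
    where open ≤-Reasoning

  reverse-involutive : ∀ x → reverse a c (reverse a c x) ≡ x
  reverse-involutive x with inside-or-outside x
  ... | inj₂ out           = trans (cong (reverse a c) (reverse-outside out)) (reverse-outside out)
  ... | inj₁ (a≤x , x<c) = +-cancelʳ-≡ (suc y) _ x (begin
    reverse a c y + suc y  ≡⟨ reverse-inside (reverse-≥ a≤x x<c) (reverse-< a≤x x<c) ⟩
    a + c                  ≡⟨ reverse-inside a≤x x<c ⟨
    y + suc x              ≡⟨ +-suc y x ⟩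
    suc (y + x)            ≡⟨ cong suc (+-comm y x) ⟩
    suc (x + y)            ≡⟨ +-suc x y ⟨
    x + suc y              ∎)
    where
    open ≡-Reasoning
    y = reverse a c x

  reverse-bounded : ∀ {n x} → c ≤ n → x < n → reverse a c x < n
  reverse-bounded {n} {x} c≤n x<n with inside-or-outside x
  ... | inj₂ out         = subst (_< n) (sym (reverse-outside out)) x<n
  ... | inj₁ (a≤x , x<c) = ≤-trans (reverse-< a≤x x<c) c≤n

-- Vertices by position, and windows of consecutive positions.

module _ {n : ℕ} .{{_ : NonZero n}} where

  vertex : Labeling n → ℕ → Fin n
  vertex π k = π ⟨$⟩ˡ (k mod n)

  -- For `m = suc d` this is definitionally `H` at an index of value `z`; for `m = d` it is a
  -- candidate ridge. Positions are read modulo `n`, so a window may wrap around.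
  window : Labeling n → ℕ → ℕ → Subset n
  window π z m = ⋃ (map (λ j → ⁅ vertex π (z + j) ⁆) (upTo m))

  mod-< : ∀ {x} (x<n : x < n) → x mod n ≡ fromℕ< x<n
  mod-< {x} x<n = fromℕ<-cong _ _ (m<n⇒m%n≡m x<n) (m%n<n x n) x<n

  vertex-+n : ∀ π k → vertex π (k + n) ≡ vertex π k
  vertex-+n π k = cong (π ⟨$⟩ˡ_) (fromℕ<-cong _ _ ([m+n]%n≡m%n k n) (m%n<n (k + n) n) (m%n<n k n))

  vertex-injective : ∀ π {x y} → x < n → y < n → vertex π x ≡ vertex π y → x ≡ y
  vertex-injective π {x} {y} x<n y<n eq = fromℕ<-injective x y x<n y<n (begin
    fromℕ< x<n                        ≡⟨ mod-< x<n ⟨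
    x mod n                           ≡⟨ inverseʳ π ⟨
    π ⟨$⟩ʳ vertex π x                 ≡⟨ cong (π ⟨$⟩ʳ_) eq ⟩
    π ⟨$⟩ʳ vertex π y                 ≡⟨ inverseʳ π ⟩
    y mod n                           ≡⟨ mod-< y<n ⟩
    fromℕ< y<n                        ∎)
    where open ≡-Reasoning

  vertex-surjective : ∀ π v → ∃[ x ] x < n × vertex π x ≡ v
  vertex-surjective π v = toℕ i , toℕ<n i ,
    trans (cong (π ⟨$⟩ˡ_) (trans (mod-< (toℕ<n i)) (fromℕ<-toℕ i (toℕ<n i)))) (inverseˡ π)
    where i = π ⟨$⟩ʳ v

  module _ (π : Labeling n) where

    ∈-window⁺ : ∀ {z m q} → z ≤ q → q < z + m → vertex π q ∈ window π z m
    ∈-window⁺ {z} {m} {q} z≤q q<z+m = subst (λ x → vertex π x ∈ window π z m) (m+[n∸m]≡n z≤q)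
      (∈-⋃⁅⁆⁺ (λ j → vertex π (z + j)) (∈-upTo⁺ (+-cancelˡ-< z _ m (subst (_< z + m) (sym (m+[n∸m]≡n z≤q)) q<z+m))))

    ∈-window⁻ : ∀ z m {v} → v ∈ window π z m → ∃[ q ] z ≤ q × q < z + m × v ≡ vertex π q
    ∈-window⁻ z m v∈ with j , j∈ , eq ← ∈-⋃⁅⁆⁻ (λ j → vertex π (z + j)) (upTo m) v∈ =
      z + j , m≤m+n z j , +-monoʳ-< z (∈-upTo⁻ j∈) , eq

    window-⊆ : ∀ {z m F} → (∀ {q} → z ≤ q → q < z + m → vertex π q ∈ F) → window π z m ⊆ F
    window-⊆ {z} {m} h v∈ with q , z≤q , q<z+m , refl ← ∈-window⁻ z m v∈ = h z≤q q<z+m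

    vertex∉window : ∀ {z m q} → z + m ≤ n → q < n → q < z ⊎ z + m ≤ q → vertex π q ∉ window π z m
    vertex∉window {z} {m} z+m≤n q<n out v∈ with q′ , z≤q′ , q′<z+m , eq ← ∈-window⁻ z m v∈
      with refl ← vertex-injective π q<n (≤-trans q′<z+m z+m≤n) eq with out
    ... | inj₁ q<z   = <⇒≱ q<z z≤q′
    ... | inj₂ z+m≤q = <⇒≱ q′<z+m z+m≤q

    window-≤ : ∀ {z z′ m} → 1 ≤ m → z + m ≤ n → z′ + m ≤ n → window π z m ⊆ window π z′ m → z′ ≤ z
    window-≤ {z} {z′} {m} 1≤m z+m≤n z′+m≤n sub
      with q , z′≤q , q< , eq ← ∈-window⁻ z′ m (sub (∈-window⁺ ≤-refl (m<m+n z 1≤m)))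
      with refl ← vertex-injective π (≤-trans (m<m+n z 1≤m) z+m≤n) (≤-trans q< z′+m≤n) eq = z′≤q

    window-injective : ∀ {z z′ m} → 1 ≤ m → z + m ≤ n → z′ + m ≤ n → window π z m ≡ window π z′ m → z ≡ z′
    window-injective 1≤m z+m≤n z′+m≤n eq = ≤-antisym
      (window-≤ 1≤m z′+m≤n z+m≤n (λ {x} → subst (x ∈_) (sym eq)))
      (window-≤ 1≤m z+m≤n z′+m≤n (λ {x} → subst (x ∈_) eq))

    ∣window∣ : ∀ {z m} → z + m ≤ n → ∣ window π z m ∣ ≡ m
    ∣window∣ {z} {m} z+m≤n = trans (∣⋃⁅⁆∣ (λ j → vertex π (z + j)) (AllPairs.applyUpTo⁺₁ id m different)) (length-upTo m)
      where
      different : ∀ {i j} → i < j → j < m → vertex π (z + i) ≢ vertex π (z + j)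
      different i<j j<m eq = <⇒≢ i<j (+-cancelˡ-≡ z _ _
        (vertex-injective π (bound (<-trans i<j j<m)) (bound j<m) eq))
        where
        bound : ∀ {k} → k < m → z + k < n
        bound k<m = ≤-trans (+-monoʳ-< z k<m) z+m≤n

  -- Labelings obtained by reversing an interval.

  reversal : ∀ a {c} → c ≤ n → Labeling n
  reversal a {c} c≤n = permutation f f f-involutive f-involutive
    where
    f : Fin n → Fin n
    f i = fromℕ< (reverse-bounded {a} c≤n (toℕ<n i))
    f-involutive : ∀ i → f (f i) ≡ i
    f-involutive i = toℕ-injective (trans (toℕ-fromℕ< _)
      (trans (cong (reverse a c) (toℕ-fromℕ< _)) (reverse-involutive {a} {c} (toℕ i))))

  reverseLabels : Labeling n → ∀ a {c} → c ≤ n → Labeling n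
  reverseLabels π a c≤n = π ∘ₚ reversal a c≤n

  module _ (π : Labeling n) (a : ℕ) {c : ℕ} (c≤n : c ≤ n) where

    private π′ = reverseLabels π a c≤n

    vertex-reverse : ∀ {x} → x < n → vertex π′ x ≡ vertex π (reverse a c x)
    vertex-reverse {x} x<n = cong (π ⟨$⟩ˡ_) (toℕ-injective (begin
      toℕ (fromℕ< (reverse-bounded {a} c≤n (toℕ<n (x mod n)))) ≡⟨ toℕ-fromℕ< _ ⟩
      reverse a c (toℕ (x mod n))      ≡⟨ cong (reverse a c) (trans (cong toℕ (mod-< x<n)) (toℕ-fromℕ< x<n)) ⟩
      reverse a c x                    ≡⟨ toℕ-fromℕ< (reverse-bounded {a} c≤n x<n) ⟨
      toℕ (fromℕ< (reverse-bounded {a} c≤n x<n)) ≡⟨ cong toℕ (mod-< (reverse-bounded {a} c≤n x<n)) ⟨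
      toℕ (reverse a c x mod n)        ∎))
      where open ≡-Reasoning

    -- Mirroring sends the last position z+m-1 to `w`, which is what the equation on `w` expresses.
    -- Inclusion suffices: faces are `down-closed`, and where equality is wanted it follows from
    -- equal sizes.
    window-reverse : ∀ {z w m} → a ≤ z → z + m ≤ c → w + (z + m) ≡ a + c → window π′ z m ⊆ window π w m
    window-reverse {z} {w} {m} a≤z z+m≤c eq = window-⊆ π′ λ {q} z≤q q<z+m →
      let
        a≤q = ≤-trans a≤z z≤q
        q<c = ≤-trans q<z+m z+m≤c
        q′  = reverse a c q
        q′+1+q≡w+z+m : q′ + suc q ≡ w + (z + m)
        q′+1+q≡w+z+m = trans (reverse-inside a≤q q<c) (sym eq)
        w≤q′ : w ≤ q′
        w≤q′ = +-cancelʳ-≤ (suc q) w q′ (≤-trans (+-monoʳ-≤ w q<z+m) (≤-reflexive (sym q′+1+q≡w+z+m)))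
        q′<w+m : q′ < w + m
        q′<w+m = +-cancelʳ-≤ q (suc q′) (w + m) (≤-trans (≤-reflexive (trans (sym (+-suc q′ q))
          (trans q′+1+q≡w+z+m (trans (cong (w +_) (+-comm z m)) (sym (+-assoc w m z)))))) (+-monoʳ-≤ (w + m) z≤q))
      in subst (_∈ window π w m) (sym (vertex-reverse (≤-trans q<c c≤n))) (∈-window⁺ π w≤q′ q′<w+m)

    vertex-unmoved : ∀ {x} → x < n → x < a ⊎ c ≤ x → vertex π′ x ≡ vertex π x
    vertex-unmoved x<n out = trans (vertex-reverse x<n) (cong (vertex π) (reverse-outside out))

    window-unmoved : ∀ {z m} → z + m ≤ n → z + m ≤ a ⊎ c ≤ z → window π′ z m ⊆ window π z m
    window-unmoved {z} {m} z+m≤n out = window-⊆ π′ λ {q} z≤q q<z+m →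
      subst (_∈ window π z m) (sym (vertex-unmoved (≤-trans q<z+m z+m≤n) (case out of λ where
        (inj₁ z+m≤a) → inj₁ (≤-trans q<z+m z+m≤a)
        (inj₂ c≤z)   → inj₂ (≤-trans c≤z z≤q))))
      (∈-window⁺ π z≤q q<z+m)

  -- Extensions of ridges, and weak chains from paths.

  module _ (Δ : SimplicialComplex n) where
    open SimplicialComplex Δ

    Extends : Subset n → Fin n → Set
    Extends ρ v = v ∉ ρ × Face (ρ ∪ ⁅ v ⁆)

    extends? : ∀ ρ → Decidable (Extends ρ)
    extends? ρ v = ¬? (v ∈? ρ) ×-dec face? (ρ ∪ ⁅ v ⁆)

    -- A d-face containing `ρ` has exactly one further vertex, and that vertex determines the face.
    degree≤count : ∀ {d} π ρ → ∣ ρ ∣ ≡ d → degree Δ d ρ ≤ count (extends? ρ ∘ vertex π) n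
    degree≤count {d} π ρ ∣ρ∣≡d = pigeonhole-≤ (λ τ x → τ ≡ ρ ∪ ⁅ vertex π x ⁆) (λ p q → trans p (sym q))
      (Unique.filter⁺ _ (allSubsets-unique n)) _ λ {τ} τ∈ → f τ (proj₂ (∈-filter⁻ _ {xs = allSubsets n} τ∈))
      where
      f : ∀ τ → FaceOfDim Δ d τ × ρ ⊆ τ → _
      f τ ((τ-face , ∣τ∣≡1+d) , ρ⊆τ)
        with p⊆q∧∣q∣≡1+∣p∣⇒q≡p∪⁅x⁆ ρ⊆τ (trans ∣τ∣≡1+d (cong suc (sym ∣ρ∣≡d)))
      ... | v , v∉ρ , refl with x , x<n , refl ← vertex-surjective π v =
        x , ∈-filter⁺ (extends? ρ ∘ vertex π) (∈-downFrom⁺ x<n) (v∉ρ , τ-face) , refl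

    FaceAt : ℕ → Labeling n → ℕ → Set
    FaceAt d π z = z < n × Face (window π z (suc d))

    module _ {d : ℕ} (π : Labeling n) where

      module _ {x y : ℕ} (r : Path (FaceAt d π) d x y) where

        index : Fin (suc (len r)) → Fin n
        index j = fromℕ< (proj₁ (node-P r j))

        toℕ-index : ∀ j → toℕ (index j) ≡ node r j
        toℕ-index j = toℕ-fromℕ< (proj₁ (node-P r j))

        H-index : ∀ j → H d π (index j) ≡ window π (node r j) (suc d)
        H-index j = cong (λ z → window π z (suc d)) (toℕ-index j)

        ∈-H-index : ∀ j {q} → node r j ≤ q → q ≤ node r j + d → vertex π q ∈ H d π (index j)
        ∈-H-index j {q} lo hi = subst (vertex π q ∈_) (sym (H-index j))
          (∈-window⁺ π lo (≤-trans (s≤s hi) (≤-reflexive (sym (+-suc _ d)))))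

        -- The path covers positions x, ..., y+d without reducing modulo `n`; the hypothesis says
        -- that every vertex has a representative among them, possibly at a position beyond n-1.
        path⇒weakChain : (∀ q → q < n → ∃[ q′ ] x ≤ q′ × q′ ≤ y + d × vertex π q′ ≡ vertex π q) →
                         WeakChain Δ d π (len r) index
        path⇒weakChain covered = record
          { increasing = λ j l j<l → subst₂ _<_ (sym (toℕ-index j)) (sym (toℕ-index l)) (node-increasing r j l j<l)
          ; faces      = λ j → subst Face (sym (H-index j)) (proj₂ (node-P r j))
          ; covering   = covering
          -- The starting vertex of the next window lies in both windows, since the gap is at most
          -- `d`.
          ; meeting    = λ j → vertex π (node r (Fin.suc j)) , x∈p∩q⁺
              ( ∈-H-index (inject₁ j) (<⇒≤ (node-increasing r (inject₁ j) (Fin.suc j) (s≤s (≤-reflexive (toℕ-inject₁ j))))) (node-gap r j)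
              , ∈-H-index (Fin.suc j) ≤-refl (m≤m+n _ d))
          }
          where
          covering : ∀ v → ∃[ j ] v ∈ H d π (index j)
          covering v with q , q<n , refl ← vertex-surjective π v
            with q′ , x≤q′ , q′≤y+d , eq ← covered q q<n
            with j , lo , hi ← node-cover r x≤q′ q′≤y+d =
            j , subst (_∈ H d π (index j)) eq (∈-H-index j lo hi)

      path⇒weaklyTraceable : ∀ {y} → suc y + d ≡ n → Path (FaceAt d π) d 0 y → MakesWeaklyTraceable Δ d π
      path⇒weaklyTraceable {y} eq r = len r , index r ,
        path⇒weakChain r (λ q q<n → q , z≤n , s≤s⁻¹ (subst (q <_) (sym eq) q<n) , refl) ,
        λ j → subst (toℕ (index r j) + d <_) eq
          (s≤s (+-monoˡ-≤ d (≤-trans (≤-reflexive (toℕ-index r j)) (node≤y r j))))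

      -- By `wrap` the last window reaches position x+n, which carries the same vertex as `x`. Hence
      -- it meets the first window, and a position q below `x` is covered as q+n.
      cyclicPath⇒weaklyHamiltonian : ∀ {x y} → x + n ≤ y + d → Path (FaceAt d π) d x y → WeaklyHamiltonian Δ d
      cyclicPath⇒weaklyHamiltonian {x} {y} wrap r = π , len r , index r , path⇒weakChain r covered ,
        vertex π x , x∈p∩q⁺
          ( subst (_∈ H d π (index r (fromℕ (len r)))) (vertex-+n π x) (∈-H-index r (fromℕ (len r)) lo hi)
          , ∈-H-index r Fin.zero ≤-refl (m≤m+n x d))
        where
        lo : node r (fromℕ (len r)) ≤ x + n
        lo = ≤-trans (<⇒≤ (proj₁ (node-P r (fromℕ (len r))))) (m≤n+m n x)
        hi : x + n ≤ node r (fromℕ (len r)) + d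
        hi = subst (λ z → x + n ≤ z + d) (sym (node-last r)) wrap
        covered : ∀ q → q < n → ∃[ q′ ] x ≤ q′ × q′ ≤ y + d × vertex π q′ ≡ vertex π q
        covered q q<n with x ≤? q
        ... | yes x≤q = q , x≤q , ≤-trans (<⇒≤ q<n) (≤-trans (m≤n+m n x) wrap) , refl
        ... | no  x≰q = q + n , ≤-trans x≤n (m≤n+m n q) , ≤-trans (+-monoˡ-≤ n (<⇒≤ (≰⇒> x≰q))) wrap , vertex-+n π q
          where
          x≤n : x ≤ n
          x≤n = <⇒≤ (proj₁ (node-P r Fin.zero))

-- The end ridges, and the cycle obtained from a crossing.

module _ {N′ d′ : ℕ} (Δ : SimplicialComplex (suc N′ + suc d′)) where
  open SimplicialComplex Δ

  private
    -- Both summands of `n` are positive by construction; the last ridge starts at `N`, and the last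
    -- window that does not wrap starts at `N′`.
    d = suc d′
    N = suc N′
    n = N + d

  first last : Labeling n → Subset n
  first π = window π 0 d
  last  π = window π N d

  Consecutive : Labeling n → Set
  Consecutive π = ∀ {z} → z < N → Face (window π z (suc d))

  traceable⇒consecutive : ∀ π → MakesTraceable Δ d π → Consecutive π
  traceable⇒consecutive π tr {z} z<N = subst (λ x → Face (window π x (suc d))) (toℕ-fromℕ< z<n)
    (tr (fromℕ< z<n) (subst (λ x → x + d < n) (sym (toℕ-fromℕ< z<n)) (+-monoˡ-< d z<N)))
    where
    z<n : z < n
    z<n = ≤-trans z<N (m≤m+n N d)

  z+1+d≤n : ∀ {z} → z < N → z + suc d ≤ n
  z+1+d≤n {z} z<N = ≤-trans (≤-reflexive (+-suc z d)) (+-monoˡ-≤ d z<N)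

  N≤N′+d : N ≤ N′ + d
  N≤N′+d = ≤-trans (s≤s (m≤m+n N′ d′)) (≤-reflexive (sym (+-suc N′ d′)))

  extendsFirst⇒d≤ : ∀ π {x} → Extends Δ (first π) (vertex π x) → d ≤ x
  extendsFirst⇒d≤ π (v∉ , _) = ≮⇒≥ λ x<d → v∉ (∈-window⁺ π z≤n x<d)

  extendsLast⇒<N : ∀ π {x} → x < n → Extends Δ (last π) (vertex π x) → x < N
  extendsLast⇒<N π x<n (v∉ , _) = ≰⇒> λ N≤x → v∉ (∈-window⁺ π N≤x x<n)

  module _ (π : Labeling n) (faces : Consecutive π) {q : ℕ} (q<N : q < N)
           (ext-first : Extends Δ (first π) (vertex π (suc q)))
           (ext-last : Extends Δ (last π) (vertex π q)) where

    private
      π′ = reverseLabels π (suc q) {n} ≤-refl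

      N′+d<n : N′ + d < n
      N′+d<n = ≤-refl

      -- In `π′` position `q` is followed by the old last ridge in reverse order.
      good-turn : Face (window π′ q (suc d))
      good-turn = down-closed (window-⊆ π′ inclusion) (proj₂ ext-last)
        where
        inclusion : ∀ {x} → q ≤ x → x < q + suc d → vertex π′ x ∈ last π ∪ ⁅ vertex π q ⁆
        inclusion {x} q≤x x< with m≤n⇒m<n∨m≡n q≤x
        ... | inj₁ q<x  = p⊆p∪q _ (window-reverse π (suc q) ≤-refl {w = N} ≤-refl (+-monoˡ-≤ d q<N) N+1+q+d≡1+q+n
                            (∈-window⁺ π′ q<x (subst (x <_) (+-suc q d) x<)))
          where
          N+1+q+d≡1+q+n : N + (suc q + d) ≡ suc q + n
          N+1+q+d≡1+q+n = trans (sym (+-assoc N (suc q) d)) (trans (cong (_+ d) (+-comm N (suc q))) (+-assoc (suc q) N d))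
        ... | inj₂ refl = q⊆p∪q (last π) _ (subst (_∈ ⁅ vertex π q ⁆)
                            (sym (vertex-unmoved π (suc q) ≤-refl (≤-trans q<N (m≤m+n N d)) (inj₁ ≤-refl))) (x∈⁅x⁆ _))

      good-reversed : ∀ {z} → q < z → z ≤ N′ → Face (window π′ z (suc d))
      good-reversed {z} q<z z≤N′ = down-closed
        (window-reverse π (suc q) ≤-refl {z} {w} q<z (z+1+d≤n (s≤s z≤N′)) w+z+1+d≡1+q+n) (faces (s≤s w≤N′))
        where
        -- The mirror image of the last position z+d of the window.
        w = suc q + N′ ∸ z
        w≤N′ : w ≤ N′
        w≤N′ = m≤n+o⇒m∸n≤o (suc q + N′) z (+-monoˡ-≤ N′ q<z)
        w+z+1+d≡1+q+n : w + (z + suc d) ≡ suc q + n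
        w+z+1+d≡1+q+n = begin
          w + (z + suc d)    ≡⟨ +-assoc w z (suc d) ⟨
          w + z + suc d      ≡⟨ cong (_+ suc d) (m∸n+n≡m (≤-trans z≤N′ (m≤n+m N′ (suc q)))) ⟩
          suc q + N′ + suc d ≡⟨ +-assoc (suc q) N′ (suc d) ⟩
          suc q + (N′ + suc d) ≡⟨ cong (suc q +_) (+-suc N′ d) ⟩
          suc q + n          ∎
          where open ≡-Reasoning

      -- Position n-1 now carries the vertex formerly at q+1, and the window wraps around to the
      -- first ridge. That ridge has not moved: q+1 extends it, hence d ≤ q+1.
      good-closing : Face (window π′ (N′ + d) (suc d))
      good-closing = down-closed (window-⊆ π′ inclusion) (proj₂ ext-first)
        where
        1+q≤N′+d : suc q ≤ N′ + d
        1+q≤N′+d = ≤-trans q<N N≤N′+d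
        inclusion : ∀ {x} → N′ + d ≤ x → x < N′ + d + suc d → vertex π′ x ∈ first π ∪ ⁅ vertex π (suc q) ⁆
        inclusion {x} N′+d≤x x< with m≤n⇒m<n∨m≡n N′+d≤x
        ... | inj₂ refl = q⊆p∪q (first π) _ (subst (_∈ ⁅ vertex π (suc q) ⁆)
                            (sym (trans (vertex-reverse π (suc q) ≤-refl N′+d<n) (cong (vertex π) r≡1+q))) (x∈⁅x⁆ _))
          where
          r≡1+q : reverse (suc q) n (N′ + d) ≡ suc q
          r≡1+q = +-cancelʳ-≡ n _ (suc q) (reverse-inside 1+q≤N′+d N′+d<n)
        ... | inj₁ n≤x = p⊆p∪q _ (subst (_∈ first π) (sym wrapped) (∈-window⁺ π z≤n j<d))
          where
          j = x ∸ n
          j+n≡x : j + n ≡ x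
          j+n≡x = m∸n+n≡m n≤x
          j<d : j < d
          j<d = +-cancelʳ-< n j d (begin-strict
            j + n           ≡⟨ j+n≡x ⟩
            x               <⟨ x< ⟩
            N′ + d + suc d  ≡⟨ +-suc (N′ + d) d ⟩
            n + d           ≡⟨ +-comm n d ⟩
            d + n           ∎)
            where open ≤-Reasoning
          wrapped : vertex π′ x ≡ vertex π j
          wrapped = trans (cong (vertex π′) (sym j+n≡x)) (trans (vertex-+n π′ j)
            (vertex-unmoved π (suc q) ≤-refl (≤-trans j<d (m≤n+m d N)) (inj₁ (≤-trans j<d (extendsFirst⇒d≤ π ext-first)))))

      suffix : Path (FaceAt Δ d π′) d q (N′ + d)
      -- After the windows at q, ..., N′ comes a jump of exactly `d` to the wrapping window at n-1.
      suffix = run z<s (s≤s⁻¹ q<N) good ⟨ m<m+n N′ z<s , ≤-refl ⟩++ stop (N′+d<n , good-closing)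
        where
        good : ∀ {z} → q ≤ z → z ≤ N′ → FaceAt Δ d π′ z
        good q≤z z≤N′ = ≤-trans (s≤s z≤N′) (m≤m+n N d) ,
          (case m≤n⇒m<n∨m≡n q≤z of λ where
            (inj₁ q<z)  → good-reversed q<z z≤N′
            (inj₂ refl) → good-turn)

      prefix : d ≤ q → Path (FaceAt Δ d π′) d 0 (q ∸ d)
      prefix d≤q = run z<s z≤n good
        where
        good : ∀ {z} → 0 ≤ z → z ≤ q ∸ d → FaceAt Δ d π′ z
        good {z} _ z≤q∸d = ≤-trans z<N (m≤m+n N d) ,
          down-closed (window-unmoved π (suc q) ≤-refl {z} {suc d} (z+1+d≤n z<N)
            (inj₁ (≤-trans (≤-reflexive (+-suc z d)) (s≤s z+d≤q)))) (faces z<N)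
          where
          z+d≤q : z + d ≤ q
          z+d≤q = ≤-trans (+-monoˡ-≤ d z≤q∸d) (≤-reflexive (m∸n+n≡m d≤q))
          z<N : z < N
          z<N = ≤-trans (s≤s (m+n≤o⇒m≤o z z+d≤q)) q<N

    -- The cycle 0, …, q, n-1, …, q+1.  For q = d-1 the windows before q do not exist,
    -- but the closing window covers the vertices at positions 0, …, d-1.
    crossing⇒weaklyHamiltonian : WeaklyHamiltonian Δ d
    crossing⇒weaklyHamiltonian with d ≤? q
    ... | no  d≰q = cyclicPath⇒weaklyHamiltonian Δ π′ (begin
      q + n              ≡⟨ +-suc q (N′ + d) ⟩
      suc q + (N′ + d)   ≤⟨ +-monoˡ-≤ (N′ + d) (≰⇒> d≰q) ⟩
      d + (N′ + d)       ≡⟨ +-comm d (N′ + d) ⟩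
      N′ + d + d         ∎) suffix
      where open ≤-Reasoning
    ... | yes d≤q = cyclicPath⇒weaklyHamiltonian Δ π′ (m<m+n (N′ + d) z<s)
      (prefix d≤q ⟨ ∸-monoʳ-< z<s d≤q , ≤-reflexive (sym (m∸n+n≡m d≤q)) ⟩++ suffix)

  -- Rotations at the first ridge.

  module _ (π : Labeling n) {p : ℕ} (p<N : p < N) where

    private
      p≤n : p ≤ n
      p≤n = ≤-trans (<⇒≤ p<N) (m≤m+n N d)

    rotate : Labeling n
    rotate = reverseLabels π 0 p≤n

    first-rotate : d ≤ p → first rotate ≡ window π (p ∸ d) d
    first-rotate d≤p = p⊆q∧∣p∣≡∣q∣⇒p≡q (window-reverse π 0 p≤n {0} {p ∸ d} {d} z≤n d≤p (m∸n+n≡m d≤p))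
      (trans (∣window∣ rotate {0} (m≤n+m d N)) (sym (∣window∣ π (≤-trans (≤-reflexive (m∸n+n≡m d≤p)) p≤n))))

    last-rotate : last rotate ≡ last π
    last-rotate = p⊆q∧∣p∣≡∣q∣⇒p≡q (window-unmoved π 0 p≤n {N} {d} ≤-refl (inj₂ (<⇒≤ p<N)))
      (trans (∣window∣ rotate {N} ≤-refl) (sym (∣window∣ π {N} ≤-refl)))

    -- Windows inside 0, ..., p-1 are mirrored and those from `p` on are unmoved. The window from
    -- p-d to p is the old first ridge together with the vertex at `p`, a face by the extension
    -- hypothesis. Starts strictly between p-d and p are skipped by a jump of `d`, as those windows
    -- may fail to be faces; hence only weak traceability.
    rotate-weaklyTraceable : Consecutive π → Extends Δ (first π) (vertex π p) → d ≤ p → MakesWeaklyTraceable Δ d rotate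
    rotate-weaklyTraceable faces ext d≤p = path⇒weaklyTraceable Δ rotate refl
      (run z<s z≤n reversed ⟨ ∸-monoʳ-< z<s d≤p , ≤-reflexive (sym (m∸n+n≡m d≤p)) ⟩++ run z<s (s≤s⁻¹ p<N) unmoved)
      where
      unmoved : ∀ {z} → p ≤ z → z ≤ N′ → FaceAt Δ d rotate z
      unmoved {z} p≤z z≤N′ = ≤-trans (s≤s z≤N′) (m≤m+n N d) ,
        down-closed (window-unmoved π 0 p≤n {z} {suc d} (z+1+d≤n (s≤s z≤N′)) (inj₂ p≤z)) (faces (s≤s z≤N′))
      turn : ∀ {z} → z + d ≡ p → Face (window rotate z (suc d))
      turn {z} z+d≡p = down-closed (window-⊆ rotate inclusion) (proj₂ ext)
        where
        inclusion : ∀ {x} → z ≤ x → x < z + suc d → vertex rotate x ∈ first π ∪ ⁅ vertex π p ⁆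
        inclusion {x} z≤x x< with x <? p
        ... | yes x<p = p⊆p∪q _ (window-reverse π 0 p≤n {z} {0} z≤n (≤-reflexive z+d≡p) z+d≡p
                          (∈-window⁺ rotate z≤x (subst (x <_) (sym z+d≡p) x<p)))
        ... | no  x≮p with refl ← ≤-antisym (≮⇒≥ x≮p) (s≤s⁻¹ (subst (x <_) (trans (+-suc z d) (cong suc z+d≡p)) x<)) =
          q⊆p∪q (first π) _ (subst (_∈ ⁅ vertex π x ⁆)
            (sym (vertex-unmoved π 0 p≤n (≤-trans p<N (m≤m+n N d)) (inj₂ ≤-refl))) (x∈⁅x⁆ _))
      reversed : ∀ {z} → 0 ≤ z → z ≤ p ∸ d → FaceAt Δ d rotate z
      reversed {z} _ z≤p∸d = ≤-trans (s≤s (≤-trans z≤p∸d (m∸n≤m p d))) (≤-trans p<N (m≤m+n N d)) , face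
        where
        z+d≤p : z + d ≤ p
        z+d≤p = ≤-trans (+-monoˡ-≤ d z≤p∸d) (≤-reflexive (m∸n+n≡m d≤p))
        face : Face (window rotate z (suc d))
        face with m≤n⇒m<n∨m≡n z+d≤p
        ... | inj₂ z+d≡p = turn z+d≡p
        ... | inj₁ z+d<p = down-closed
          (window-reverse π 0 p≤n {z} {p ∸ (z + suc d)} z≤n z+1+d≤p (m∸n+n≡m z+1+d≤p))
          (faces (≤-trans (s≤s (m∸n≤m p (z + suc d))) p<N))
          where
          z+1+d≤p : z + suc d ≤ p
          z+1+d≤p = ≤-trans (≤-reflexive (+-suc z d)) z+d<p

  -- Reversal of the whole labeling.

  flip : Labeling n → Labeling n
  flip π = reverseLabels π 0 {n} ≤-refl

  first-flip : ∀ π → first (flip π) ≡ last π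
  first-flip π = p⊆q∧∣p∣≡∣q∣⇒p≡q (window-reverse π 0 ≤-refl {0} {N} z≤n (m≤n+m d N) refl)
    (trans (∣window∣ (flip π) {0} (m≤n+m d N)) (sym (∣window∣ π {N} ≤-refl)))

  last-flip : ∀ π → last (flip π) ≡ first π
  last-flip π = p⊆q∧∣p∣≡∣q∣⇒p≡q (window-reverse π 0 ≤-refl {N} {0} z≤n ≤-refl refl)
    (trans (∣window∣ (flip π) {N} ≤-refl) (sym (∣window∣ π {0} (m≤n+m d N))))

  flip-consecutive : ∀ π → Consecutive π → Consecutive (flip π)
  flip-consecutive π faces {z} z<N = down-closed
    (window-reverse π 0 ≤-refl {z} {N′ ∸ z} z≤n (z+1+d≤n z<N) (begin
      N′ ∸ z + (z + suc d)  ≡⟨ +-assoc (N′ ∸ z) z (suc d) ⟨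
      N′ ∸ z + z + suc d    ≡⟨ cong (_+ suc d) (m∸n+n≡m (s≤s⁻¹ z<N)) ⟩
      N′ + suc d            ≡⟨ +-suc N′ d ⟩
      n                     ∎))
    (faces (s≤s (m∸n≤m N′ z)))
    where open ≡-Reasoning

  -- The degree sum of the end ridges, and crossings.

  degreeSum : Labeling n → ℕ
  degreeSum π = degree Δ d (first π) + degree Δ d (last π)

  degreeSum-flip : ∀ π → degreeSum (flip π) ≡ degreeSum π
  degreeSum-flip π = trans (cong₂ (λ ρ ρ′ → degree Δ d ρ + degree Δ d ρ′) (first-flip π) (last-flip π))
    (+-comm (degree Δ d (last π)) _)

  Crossing : Labeling n → ℕ → Set
  Crossing π q = Extends Δ (first π) (vertex π (suc q)) × Extends Δ (last π) (vertex π q)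

  crossing? : ∀ π → Dec (∃[ q ] q < N × Crossing π q)
  crossing? π = anyUpTo? (λ q → extends? Δ (first π) (vertex π (suc q)) ×-dec extends? Δ (last π) (vertex π q)) N

  -- Without a crossing, the positions extending the last ridge are disjoint from those extending
  -- the first ridge shifted down by one. Both sets lie in 0, ..., n-2, because position 0 is in the
  -- first ridge and n-1 in the last.
  degreeSum<n : ∀ π → ¬ (∃[ q ] q < N × Crossing π q) → degreeSum π < n
  degreeSum<n π ¬cross = s≤s (begin
    degree Δ d (first π) + degree Δ d (last π) ≤⟨ +-mono-≤ (degree≤count Δ π (first π) (∣window∣ π {0} (m≤n+m d N)))
                                                           (degree≤count Δ π (last π) (∣window∣ π {N} ≤-refl)) ⟩
    count S? n + count T? n                    ≡⟨ cong (count S? n +_) (count-reject T? λ (v∉ , _) →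
                                                    v∉ (∈-window⁺ π N≤N′+d ≤-refl)) ⟩
    count S? n + count T? (N′ + d)             ≤⟨ count-shifted S? T? (λ ext → case extendsFirst⇒d≤ π {0} ext of λ ()) (N′ + d)
                                                    (λ {x} x< s t → ¬cross (x , extendsLast⇒<N π (m≤n⇒m≤1+n x<) t , s , t)) ⟩
    N′ + d                                     ∎)
    where
    open ≤-Reasoning
    S? = λ x → extends? Δ (first π) (vertex π x)
    T? = λ x → extends? Δ (last π) (vertex π x)

  -- Counting ridges of low degree.

  module _ {s : ℕ} {σ : Fin s → Subset n} (ridges : DegreeOrderedRidges Δ d s σ) (d<N : d < N)
           (large : ∀ k → d ≤ k → 2 * k < n → ∀ (j : Fin s) → toℕ j ≡ k ∸ d → k < degree Δ d (σ j))
           where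
    open DegreeOrderedRidges ridges using (complete; monotone)

    -- If `F` had index at least k-d, `monotone` would give the ridge at index k-d degree at most
    -- `k`, against `large`. As indices start at 0, that ridge is the one with degree d_{k-d+1}.
    lowDegree⇒smallIndex : ∀ {k F} → d ≤ k → 2 * k < n → FaceOfDim Δ d′ F → degree Δ d F ≤ k →
                           ∃[ j ] toℕ j < k ∸ d × σ j ≡ F
    lowDegree⇒smallIndex {k} {F} d≤k 2k<n F-ridge degF≤k with j , refl ← complete F F-ridge =
      j , ≰⇒> (λ k∸d≤j → <⇒≱ (large k d≤k 2k<n (j₀ k∸d≤j) (toℕ-fromℕ< _))
        (≤-trans (monotone (j₀ k∸d≤j) j (≤-trans (≤-reflexive (toℕ-fromℕ< _)) k∸d≤j)) degF≤k)) , refl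
      where
      -- Index k-d exists in `Fin s` because the index of `F` is at least as big.
      j₀ : k ∸ d ≤ toℕ j → Fin s
      j₀ k∸d≤j = fromℕ< (≤-<-trans k∸d≤j (toℕ<n j))

    module _ (π : Labeling n) (faces : Consecutive π) where

      private a = degree Δ d (first π)

      ridge : ∀ {z} → z < N → FaceOfDim Δ d′ (window π z d)
      ridge {z} z<N = down-closed (window-⊆ π λ z≤q q<z+d → ∈-window⁺ π z≤q (≤-trans q<z+d (+-monoʳ-≤ z (n≤1+n d)))) (faces z<N) ,
        ∣window∣ π {z} (+-monoˡ-≤ d (<⇒≤ z<N))

      -- For k = d no index is below k-d = 0, so no ridge has degree at most `d`; the value k = d is
      -- admissible because n > 2d.
      d≤degree-first : d ≤ a
      d≤degree-first = ≮⇒≥ λ a<d → case lowDegree⇒smallIndex ≤-refl 2d<n (ridge z<s) (<⇒≤ a<d) of λ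
        (j , j<d∸d , _) → n≮0 (subst (toℕ j <_) (n∸n≡0 d) j<d∸d)
        where
        2d<n : 2 * d < n
        2d<n = subst (_< n) (cong (d +_) (sym (+-identityʳ d))) (+-monoˡ-< d d<N)

      -- The extensions of the first ridge at positions beyond N number at most d-1 and position N
      -- would give a crossing, so at least a-d+1 extensions lie below N, and each yields a ridge
      -- of degree at most a; but only a-d ridges have so small a degree.
      ¬allLow : ¬ (∃[ q ] q < N × Crossing π q) → 2 * a < n →
                ¬ (∀ {p} → p < N → Extends Δ (first π) (vertex π p) → degree Δ d (window π (p ∸ d) d) ≤ a)
      ¬allLow ¬cross 2a<n low = <-irrefl refl (begin-strict
        a                      ≤⟨ degree≤count Δ π (first π) (∣window∣ π {0} (m≤n+m d N)) ⟩
        count S? n             ≡⟨ cong (count S?) (+-suc N d′) ⟩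
        count S? (suc N + d′)  ≤⟨ count-+-≤ S? (suc N) d′ ⟩
        count S? (suc N) + d′  ≡⟨ cong (_+ d′) (count-reject S? λ ext → ¬cross (N′ , ≤-refl , ext , N′-extends-last)) ⟩
        count S? N + d′        ≤⟨ +-monoˡ-≤ d′ countN≤a∸d ⟩
        a ∸ d + d′             <⟨ +-monoʳ-< (a ∸ d) ≤-refl ⟩
        a ∸ d + d              ≡⟨ m∸n+n≡m d≤degree-first ⟩
        a                      ∎)
        where
        open ≤-Reasoning
        S? = λ x → extends? Δ (first π) (vertex π x)
        -- The last ridge together with position `N′` is the window at `N′`.
        N′-extends-last : Extends Δ (last π) (vertex π N′)
        N′-extends-last = vertex∉window π {N} ≤-refl (m≤m+n N d) (inj₁ ≤-refl) ,
          down-closed (λ v∈ → [ window-⊆ π {N} {d} (λ N≤q q<n → ∈-window⁺ π {N′} {suc d} (<⇒≤ N≤q) (≤-trans q<n (≤-reflexive (sym (+-suc N′ d)))))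
                              , (λ v∈⁅⁆ → subst (_∈ window π N′ (suc d)) (sym (x∈⁅y⁆⇒x≡y _ v∈⁅⁆)) (∈-window⁺ π {N′} {suc d} ≤-refl (m<m+n N′ z<s)))
                              ]′ (x∈p∪q⁻ (last π) _ v∈)) (faces ≤-refl)
        -- Relates `p` to the index of the ridge ending at p-1; distinct `p` give distinct windows,
        -- so the relation is injective.
        R : ℕ → ℕ → Set
        R p y = d ≤ p × p < N × ∃[ j ] toℕ j ≡ y × σ j ≡ window π (p ∸ d) d
        fits : ∀ {p} → d ≤ p → p < N → p ∸ d + d ≤ n
        fits d≤p p<N = ≤-trans (≤-reflexive (m∸n+n≡m d≤p)) (≤-trans (<⇒≤ p<N) (m≤m+n N d))
        R-injective : ∀ {p p′ y} → R p y → R p′ y → p ≡ p′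
        R-injective {p} {p′} (d≤p , p<N , j , refl , eq) (d≤p′ , p′<N , j′ , j′≡j , eq′) with refl ← toℕ-injective j′≡j =
          ∸-cancelʳ-≡ d≤p d≤p′ (window-injective π {p ∸ d} {p′ ∸ d} {d} z<s (fits d≤p p<N) (fits d≤p′ p′<N) (trans (sym eq) eq′))
        countN≤a∸d : count S? N ≤ a ∸ d
        countN≤a∸d = subst (count S? N ≤_) (length-downFrom (a ∸ d))
          (pigeonhole-≤ R R-injective (Unique.filter⁺ S? (Unique.downFrom⁺ N)) (downFrom (a ∸ d)) λ {p} p∈ →
            let p∈N , ext = ∈-filter⁻ S? {xs = downFrom N} p∈
                p<N = ∈-downFrom⁻ p∈N
                j , j<a∸d , eq = lowDegree⇒smallIndex d≤degree-first 2a<n (ridge (≤-trans (s≤s (m∸n≤m p d)) p<N)) (low p<N ext)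
            in toℕ j , ∈-downFrom⁺ j<a∸d , extendsFirst⇒d≤ π ext , p<N , j , refl , eq)

    -- Increasing the degree sum until a crossing appears.

    module _ (weak⇒traceable : ∀ π → MakesWeaklyTraceable Δ d π → MakesTraceable Δ d π) where

      improve : ∀ π → Consecutive π → ¬ (∃[ q ] q < N × Crossing π q) → 2 * degree Δ d (first π) < n →
                ∃[ π′ ] Consecutive π′ × degreeSum π < degreeSum π′
      improve π faces ¬cross 2a<n
        -- The bounded search either produces a suitable position or fails, and failure is what
        -- `¬allLow` refutes.
        with anyUpTo? (λ p → extends? Δ (first π) (vertex π p) ×-dec (degree Δ d (first π) <? degree Δ d (window π (p ∸ d) d))) N
      ... | no  ¬high = contradiction (λ {p} p<N ext → ≮⇒≥ λ high → ¬high (p , p<N , ext , high)) (¬allLow π faces ¬cross 2a<n)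
      ... | yes (p , p<N , ext , high) = rotate π p<N ,
        traceable⇒consecutive (rotate π p<N) (weak⇒traceable _ (rotate-weaklyTraceable π p<N faces ext d≤p)) ,
        subst₂ (λ ρ ρ′ → degreeSum π < degree Δ d ρ + degree Δ d ρ′)
          (sym (first-rotate π p<N d≤p)) (sym (last-rotate π p<N)) (+-monoˡ-< (degree Δ d (last π)) high)
        where d≤p = extendsFirst⇒d≤ π ext

      -- `fuel` bounds the distance of the degree sum from `n`. Each improvement costs one unit, and
      -- without fuel the sum is at least `n`, which forces a crossing.
      search : ∀ fuel π → Consecutive π → n ≤ fuel + degreeSum π → WeaklyHamiltonian Δ d
      search fuel π faces bound with crossing? π
      ... | yes (q , q<N , ext-first , ext-last) = crossing⇒weaklyHamiltonian π faces q<N ext-first ext-last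
      search zero       π faces bound | no ¬cross = contradiction bound (<⇒≱ (degreeSum<n π ¬cross))
      search (suc fuel) π faces bound | no ¬cross = continue better
        where
        a = degree Δ d (first π)
        b = degree Δ d (last π)
        continue : WeaklyHamiltonian Δ d ⊎ ∃[ π′ ] Consecutive π′ × degreeSum π < degreeSum π′ → WeaklyHamiltonian Δ d
        continue (inj₁ wh) = wh
        continue (inj₂ (π′ , faces′ , less)) = search fuel π′ faces′
          (≤-trans bound (≤-trans (≤-reflexive (sym (+-suc fuel _))) (+-monoʳ-≤ fuel less)))
        double : ∀ {x y} → x ≤ y → x + y < n → 2 * x < n
        double {x} x≤y x+y<n = ≤-<-trans (+-monoʳ-≤ x (≤-trans (≤-reflexive (+-identityʳ x)) x≤y)) x+y<n
        better : WeaklyHamiltonian Δ d ⊎ ∃[ π′ ] Consecutive π′ × degreeSum π < degreeSum π′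
        -- When b ≤ a, the flipped labeling is improved instead. Its crossings are decided afresh
        -- rather than translated from `π`: a crossing there already finishes the proof.
        better with ≤-total a b | crossing? (flip π)
        ... | inj₁ a≤b | _ = inj₂ (improve π faces ¬cross (double a≤b (degreeSum<n π ¬cross)))
        ... | inj₂ _   | yes (q , q<N , ext-first , ext-last) =
          inj₁ (crossing⇒weaklyHamiltonian (flip π) (flip-consecutive π faces) q<N ext-first ext-last)
        ... | inj₂ b≤a | no ¬cross′
          with π′ , faces′ , less ← improve (flip π) (flip-consecutive π faces) ¬cross′
                 (subst (λ ρ → 2 * degree Δ d ρ < n) (sym (first-flip π))
                   (double b≤a (subst (_< n) (+-comm a b) (degreeSum<n π ¬cross)))) =
          inj₂ (π′ , faces′ , subst (_< degreeSum π′) (degreeSum-flip π) less)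

-- Splitting n as N + d and starting the search.

m≤n⇒∃[o]o+m≡n : ∀ {m n} → m ≤ n → ∃[ o ] o + m ≡ n
m≤n⇒∃[o]o+m≡n {m} {n} m≤n = n ∸ m , m∸n+n≡m m≤n

theorem2 : ∀ (d n : ℕ) → 1 ≤ d → 2 * d < n →
    (Δ : SimplicialComplex n) → PureOfDim Δ d → Traceable Δ d →
    (∀ (π : Labeling n) → MakesWeaklyTraceable Δ d π → MakesTraceable Δ d π) →
    ∀ (s : ℕ) (σ : Fin s → Subset n) → DegreeOrderedRidges Δ d s σ →
    (∀ (k : ℕ) → d ≤ k → 2 * k < n → ∀ (j : Fin s) → toℕ j ≡ k ∸ d → k < degree Δ d (σ j)) →
    WeaklyHamiltonian Δ d
theorem2 (suc d′) n 1≤d 2d<n Δ _ (π , traceable) weak⇒traceable s σ ridges large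
  with N , refl ← m≤n⇒∃[o]o+m≡n (≤-trans (m≤m+n (suc d′) _) (<⇒≤ 2d<n))
  -- Cancelling `d` in 2d < N + d; this also rules out N = 0 in the next match.
  with d<N ← +-cancelʳ-< (suc d′) (suc d′) N (subst (_< N + suc d′) (cong (suc d′ +_) (+-identityʳ (suc d′))) 2d<n)
  with suc N′ ← N =
  -- Fuel `n` is enough for any initial degree sum.
  search Δ ridges d<N large weak⇒traceable (suc N′ + suc d′) π (traceable⇒consecutive Δ π traceable) (m≤m+n _ _)
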